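{- For $n\ge 0$ let $$Q_n(x_1,\ldots,x_7)=\sum_{\sigma\in\mathcal{S}_n(132)} x_1^{\mathrm{occr}_{12}(\sigma)}x_2^{\mathrm{occr}_{21}(\sigma)}x_3^{\mathrm{occr}_{123}(\sigma)}x_4^{\mathrm{occr}_{213}(\sigma)}x_5^{\mathrm{occr}_{231}(\sigma)}x_6^{\mathrm{occr}_{312}(\sigma)}x_7^{\mathrm{occr}_{321}(\sigma)}.$$ Then $Q_0(x_1,\ldots,x_7)=1$ and, for every $n\ge 1$, $$Q_n(x_1,\ldots,x_7)=\sum_{k=1}^{n} x_1^{k-1}x_2^{k(n-k)}x_5^{(k-1)(n-k)}\; Q_{k-1}\!\left(x_1x_3x_5^{\,n-k},\,x_2x_4x_7^{\,n-k},\,x_3,x_4,x_5,x_6,x_7\right)\; Q_{n-k}\!\left(x_1x_6^{\,k},\,x_2x_7^{\,k},\,x_3,x_4,x_5,x_6,x_7\right).$$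
   Context: $\mathcal{S}_n$ is the set of permutations of $\{1,\ldots,n\}$ in one-line notation ($\mathcal{S}_0$ consists of the empty permutation). For a sequence $w$ of distinct integers, $\mathrm{red}(w)$ is the permutation obtained by replacing the $i$-th smallest entry of $w$ by $i$. For $\tau\in\mathcal{S}_j$ and $\sigma=\sigma_1\cdots\sigma_n\in\mathcal{S}_n$, $\mathrm{occr}_\tau(\sigma)$ is the number of index sets $1\le i_1<\cdots<i_j\le n$ with $\mathrm{red}(\sigma_{i_1}\cdots\sigma_{i_j})=\tau$. The permutation $\sigma$ avoids $\tau$ if $\mathrm{occr}_\tau(\sigma)=0$, and $\mathcal{S}_n(\tau)$ is the set of $\sigma\in\mathcal{S}_n$ avoiding $\tau$. -}

module Defs where

open import Algebra.Bundles using (CommutativeRing)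
open import Data.List.Base
  using (List; []; _∷_; [_]; _++_; map; foldr; filter; length; upTo; cartesianProductWith)
open import Data.List.Properties using (≡-dec)
open import Data.List.Relation.Unary.Unique.DecPropositional using (unique?)
open import Data.Nat.Base using (ℕ; zero; suc)
open import Data.Nat.Properties using (_≟_; _≤?_)

-- A permutation is its one-line notation, with entries starting from 1.
Word : Set
Word = List ℕ

[1⋯_] : ℕ → List ℕ
[1⋯ n ] = map suc (upTo n)

words : List ℕ → ℕ → List Word
words as zero    = [ [] ]
words as (suc m) = cartesianProductWith _∷_ as (words as m)

𝒮 : ℕ → List Word
𝒮 n = filter (unique? _≟_) (words [1⋯ n ] n)

-- The rank of a among distinct entries w is the number of entries ≤ a.
red : Word → Word
red w = map (λ a → length (filter (_≤? a) w)) w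

-- One entry σ_{i₁} ⋯ σ_{iⱼ} for each index set i₁ < ⋯ < iⱼ.
subsequences : ℕ → Word → List Word
subsequences zero    σ       = [ [] ]
subsequences (suc j) []      = []
subsequences (suc j) (a ∷ σ) = map (a ∷_) (subsequences j σ) ++ subsequences (suc j) σ

occr : Word → Word → ℕ
occr τ σ = length (filter (λ w → ≡-dec _≟_ (red w) τ) (subsequences (length τ) σ))

𝒮-avoiding : ℕ → Word → List Word
𝒮-avoiding n τ = filter (λ σ → occr τ σ ≟ 0) (𝒮 n)

-- Polynomial identities are stated for values of the variables in an arbitrary
-- commutative ring; taking the indeterminates of ℤ[x₁,…,x₇] gives the formal ones.
module Generating {c ℓ} (R : CommutativeRing c ℓ) where
  open CommutativeRing R
  open import Algebra.Properties.CommutativeSemiring.Exp commutativeSemiring public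
    using (_^_)

  infix 5 ∑
  ∑ : ∀ {a} {A : Set a} → List A → (A → Carrier) → Carrier
  ∑ as f = foldr _+_ 0# (map f as)

  syntax ∑ as (λ a → e) = ∑[ a ∈ as ] e

  Q : ℕ → (x₁ x₂ x₃ x₄ x₅ x₆ x₇ : Carrier) → Carrier
  Q n x₁ x₂ x₃ x₄ x₅ x₆ x₇ =
    ∑[ σ ∈ 𝒮-avoiding n (1 ∷ 3 ∷ 2 ∷ []) ]
      x₁ ^ occr (1 ∷ 2 ∷ []) σ *
      x₂ ^ occr (2 ∷ 1 ∷ []) σ *
      x₃ ^ occr (1 ∷ 2 ∷ 3 ∷ []) σ *
      x₄ ^ occr (2 ∷ 1 ∷ 3 ∷ []) σ *
      x₅ ^ occr (2 ∷ 3 ∷ 1 ∷ []) σ *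
      x₆ ^ occr (3 ∷ 1 ∷ 2 ∷ []) σ *
      x₇ ^ occr (3 ∷ 2 ∷ 1 ∷ []) σ

{-# OPTIONS --safe #-}
module Submission where

-- Write σ = A n B around its largest entry n.  A 132 using n as its 3 is exactly a pair
-- a < b with a in A and b in B, so σ avoids 132 iff A and B do and every entry of A
-- exceeds every entry of B.  Then B is a permutation R of 1,…,|B| and A is a permutation
-- L shifted up by |B|.  The pattern of a subsequence of σ is now determined by the
-- patterns of its parts in L and R: for instance a 12 in L extends to one 123 (by n) and
-- to |R| occurrences of 231 (by an entry of R).  Counts linear in occurrences of 12 or 21
-- in L or R become the substitutions for x₁ and x₂; the remaining constants become the
-- prefactor, with k = |L| + 1.

open import Algebra.Bundles using (CommutativeRing)
import Algebra.Solver.CommutativeMonoid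
open import Data.List.Base using (List; []; _∷_; _++_; map; foldr; concatMap; cartesianProduct; length; upTo)
open import Data.List.Membership.Propositional using (_∈_)
open import Data.List.Membership.Propositional.Properties using (∈-cartesianProduct⁻)
open import Data.List.Properties using (map-∘)
open import Data.List.Relation.Binary.Permutation.Propositional as ↭ using (_↭_)
open import Data.List.Relation.Unary.Any using (here; there)
open import Data.Nat.Base as ℕ using (ℕ; suc; _∸_; _≤_)
open import Data.Product.Base using (_×_; _,_; proj₁; proj₂; uncurry)
open import Function.Base using (_∘_)
open import Relation.Binary.PropositionalEquality as ≡ using (_≡_)
open import Defs

module Combinatorics where

  open import Data.Bool.Base using (true; false; if_then_else_)
  open import Data.List.Base using ([_]; filter)
  open import Data.List.Membership.DecPropositional using (_∈?_)
  open import Data.List.Membership.Propositional using (_∉_; find; lose)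
  open import Data.List.Membership.Propositional.Properties hiding (∈-cartesianProduct⁻)
  open import Data.List.Membership.Propositional.Properties.WithK using (unique∧set⇒bag)
  open import Data.List.Properties
    using (≡-dec; ∷-injective; ++-identityʳ; filter-++; filter-all; filter-none; length-++; length-map;
           length-upTo; map-++; map-cong; map-cong-local; map-id; map-injective)
  open import Data.List.Relation.Binary.BagAndSetEquality using (∼bag⇒↭)
  open import Data.List.Relation.Binary.Disjoint.Propositional using (Disjoint)
  open import Data.List.Relation.Unary.All as All using (All; []; _∷_)
  import Data.List.Relation.Unary.All.Properties as All
  open import Data.List.Relation.Unary.AllPairs as AllPairs using ([]; _∷_)
  import Data.List.Relation.Unary.AllPairs.Properties as AllPairs
  open import Data.List.Relation.Unary.Unique.DecPropositional using (unique?)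
  open import Data.List.Relation.Unary.Unique.Propositional using (Unique)
  import Data.List.Relation.Unary.Unique.Propositional.Properties as Unique
  open import Data.Nat.Base hiding (ℕ; suc; _∸_; _≤_)
  open import Data.Nat.ListAction using (sum)
  open import Data.Nat.ListAction.Properties using (sum-++)
  open import Data.Nat.Properties
  open import Data.Nat.Solver using (module +-*-Solver)
  open import Data.Product.Base using (∃₂)
  open import Data.Sum.Base using (inj₁; inj₂)
  open import Data.Unit.Base using (⊤; tt)
  open import Function.Base using (const)
  open import Function.Bundles using (mk⇔)
  open import Relation.Binary.PropositionalEquality
    using (_≢_; refl; sym; trans; cong; cong₂; subst; module ≡-Reasoning)
  open import Relation.Nullary using (Dec; does; yes; no; contradiction)
  open import Relation.Nullary.Decidable using (dec-false)
  open +-*-Solver using (solve; _:+_; _:*_; _:=_; con)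

  -- Sums over subsequences

  ∑ₛ : ℕ → (Word → ℕ) → Word → ℕ
  ∑ₛ zero    f σ       = f []
  ∑ₛ (suc j) f []      = 0
  ∑ₛ (suc j) f (a ∷ σ) = ∑ₛ j (f ∘ (a ∷_)) σ + ∑ₛ (suc j) f σ

  ∑ₛ-sum : ∀ j f σ → ∑ₛ j f σ ≡ sum (map f (subsequences j σ))
  ∑ₛ-sum zero    f σ       = sym (+-identityʳ _)
  ∑ₛ-sum (suc j) f []      = refl
  ∑ₛ-sum (suc j) f (a ∷ σ) = begin
    ∑ₛ j (f ∘ (a ∷_)) σ + ∑ₛ (suc j) f σ                    ≡⟨ cong₂ _+_ (∑ₛ-sum j _ σ) (∑ₛ-sum (suc j) f σ) ⟩
    sum (map (f ∘ (a ∷_)) us) + sum (map f vs)               ≡⟨ cong (λ w → sum w + _) (map-∘ us) ⟩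
    sum (map f (map (a ∷_) us)) + sum (map f vs)             ≡⟨ sum-++ (map f (map (a ∷_) us)) _ ⟨
    sum (map f (map (a ∷_) us) ++ map f vs)                  ≡⟨ cong sum (map-++ f (map (a ∷_) us) vs) ⟨
    sum (map f (map (a ∷_) us ++ vs))                        ∎
    where
    open ≡-Reasoning
    us = subsequences j σ
    vs = subsequences (suc j) σ

  -- Subsequences inherit any property shared by all entries of the word, so order hypotheses on `σ`
  -- reach every `u` that is summed over.
  ∑ₛ-cong : ∀ {P : ℕ → Set} j {f g σ} → All P σ →
            (∀ {u} → length u ≡ j → All P u → f u ≡ g u) → ∑ₛ j f σ ≡ ∑ₛ j g σ
  ∑ₛ-cong zero    ps       f≗g = f≗g refl []
  ∑ₛ-cong (suc j) []       f≗g = refl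
  ∑ₛ-cong (suc j) (p ∷ ps) f≗g =
    cong₂ _+_ (∑ₛ-cong j ps λ eq qs → f≗g (cong suc eq) (p ∷ qs)) (∑ₛ-cong (suc j) ps f≗g)

  ∑ₛ-zero : ∀ j σ → ∑ₛ j (const 0) σ ≡ 0
  ∑ₛ-zero zero    σ       = refl
  ∑ₛ-zero (suc j) []      = refl
  ∑ₛ-zero (suc j) (a ∷ σ) = cong₂ _+_ (∑ₛ-zero j σ) (∑ₛ-zero (suc j) σ)

  ∑ₛ-* : ∀ j c f σ → ∑ₛ j (λ u → c * f u) σ ≡ c * ∑ₛ j f σ
  ∑ₛ-* zero    c f σ       = refl
  ∑ₛ-* (suc j) c f []      = sym (*-zeroʳ c)
  ∑ₛ-* (suc j) c f (a ∷ σ) =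
    trans (cong₂ _+_ (∑ₛ-* j c _ σ) (∑ₛ-* (suc j) c f σ)) (sym (*-distribˡ-+ c _ _))

  ∑ₛ-+ : ∀ j f g σ → ∑ₛ j (λ u → f u + g u) σ ≡ ∑ₛ j f σ + ∑ₛ j g σ
  ∑ₛ-+ zero    f g σ       = refl
  ∑ₛ-+ (suc j) f g []      = refl
  ∑ₛ-+ (suc j) f g (a ∷ σ) =
    trans (cong₂ _+_ (∑ₛ-+ j _ _ σ) (∑ₛ-+ (suc j) f g σ))
      (solve 4 (λ p q r s →
          (p :+ q) :+ (r :+ s)
            := (p :+ r) :+ (q :+ s)) refl
        (∑ₛ j (f ∘ (a ∷_)) σ) _ _ _)

  ∑ₛ₁-const : ∀ c σ → ∑ₛ 1 (const c) σ ≡ length σ * c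
  ∑ₛ₁-const c []      = refl
  ∑ₛ₁-const c (a ∷ σ) = cong (c +_) (∑ₛ₁-const c σ)

  ∑ₛ₁≡0 : ∀ {f σ a} → ∑ₛ 1 f σ ≡ 0 → a ∈ σ → f [ a ] ≡ 0
  ∑ₛ₁≡0 eq (here refl) = m+n≡0⇒m≡0 _ eq
  ∑ₛ₁≡0 {f} {b ∷ σ} eq (there a∈σ) = ∑ₛ₁≡0 {f} (m+n≡0⇒n≡0 (f [ b ]) eq) a∈σ

  ∑ₛ-++₁ : ∀ f A B → ∑ₛ 1 f (A ++ B) ≡ ∑ₛ 1 f A + ∑ₛ 1 f B
  ∑ₛ-++₁ f []      B = refl
  ∑ₛ-++₁ f (a ∷ A) B = trans (cong (f [ a ] +_) (∑ₛ-++₁ f A B)) (sym (+-assoc (f [ a ]) _ _))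

  ∑ₛ-++₂ : ∀ f A B →
    ∑ₛ 2 f (A ++ B) ≡ ∑ₛ 2 f A + ∑ₛ 1 (λ u → ∑ₛ 1 (λ v → f (u ++ v)) B) A + ∑ₛ 2 f B
  ∑ₛ-++₂ f []      B = refl
  ∑ₛ-++₂ f (a ∷ A) B =
    trans (cong₂ _+_ (∑ₛ-++₁ (f ∘ (a ∷_)) A B) (∑ₛ-++₂ f A B))
      (solve 5 (λ p q r s t →
          (p :+ q) :+ (r :+ s :+ t)
            := (p :+ r) :+ (q :+ s) :+ t) refl
        (∑ₛ 1 (f ∘ (a ∷_)) A) _ _ _ _)

  -- The four summands sort the triples by having three, two, one or no letters in `A`. Positions in
  -- `A` come first, so a mixed triple is a part `u` from `A` followed by a part `v` from `B`.
  ∑ₛ-++₃ : ∀ f A B →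
    ∑ₛ 3 f (A ++ B) ≡ ∑ₛ 3 f A + ∑ₛ 2 (λ u → ∑ₛ 1 (λ v → f (u ++ v)) B) A
                    + ∑ₛ 1 (λ u → ∑ₛ 2 (λ v → f (u ++ v)) B) A + ∑ₛ 3 f B
  ∑ₛ-++₃ f []      B = refl
  ∑ₛ-++₃ f (a ∷ A) B =
    trans (cong₂ _+_ (∑ₛ-++₂ (f ∘ (a ∷_)) A B) (∑ₛ-++₃ f A B))
      (solve 7 (λ p q r s t u v → (p :+ q :+ r) :+ (s :+ t :+ u :+ v)
                  := (p :+ s) :+ (q :+ t) :+ (r :+ u) :+ v) refl
        (∑ₛ 2 (f ∘ (a ∷_)) A) _ _ _ _ _ _)

  -- Pattern counts as sums of indicators

  infix 4 _≟ʷ_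
  _≟ʷ_ : (u v : Word) → Dec (u ≡ v)
  _≟ʷ_ = ≡-dec _≟_

  𝟙 : ∀ {p} {P : Set p} → Dec P → ℕ
  𝟙 P? = if does P? then 1 else 0

  𝟙-cong : ∀ {p q} {P : Set p} {Q : Set q} (P? : Dec P) (Q? : Dec Q) →
           (P → Q) → (Q → P) → 𝟙 P? ≡ 𝟙 Q?
  𝟙-cong (yes p) (yes q) to from = refl
  𝟙-cong (yes p) (no ¬q) to from = contradiction (to p) ¬q
  𝟙-cong (no ¬p) (yes q) to from = contradiction (from q) ¬p
  𝟙-cong (no ¬p) (no ¬q) to from = refl

  length-filter-𝟙 : ∀ {a p} {A : Set a} {P : A → Set p} (P? : ∀ x → Dec (P x)) xs →
                    length (filter P? xs) ≡ sum (map (𝟙 ∘ P?) xs)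
  length-filter-𝟙 P? []       = refl
  length-filter-𝟙 P? (x ∷ xs) with does (P? x)
  ... | true  = cong suc (length-filter-𝟙 P? xs)
  ... | false = length-filter-𝟙 P? xs

  -- This makes the splitting rules for concatenations available for pattern counts.
  occr-∑ₛ : ∀ τ σ → occr τ σ ≡ ∑ₛ (length τ) (λ w → 𝟙 (red w ≟ʷ τ)) σ
  occr-∑ₛ τ σ = trans (length-filter-𝟙 (λ w → red w ≟ʷ τ) (subsequences (length τ) σ))
                      (sym (∑ₛ-sum (length τ) _ σ))

  -- Invariance of patterns under order embeddings

  module _ {f : ℕ → ℕ} (mono : ∀ {a b} → a ≤ b → f a ≤ f b) (cancel : ∀ {a b} → f a ≤ f b → a ≤ b) where

    private
      rank-map : ∀ a w → length (filter (_≤? f a) (map f w)) ≡ length (filter (_≤? a) w)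
      rank-map a w = begin
        length (filter (_≤? f a) (map f w))     ≡⟨ length-filter-𝟙 (_≤? f a) (map f w) ⟩
        sum (map (λ b → 𝟙 (b ≤? f a)) (map f w)) ≡⟨ cong sum (map-∘ w) ⟨
        sum (map (λ b → 𝟙 (f b ≤? f a)) w)
          ≡⟨ cong sum (map-cong (λ b → 𝟙-cong (f b ≤? f a) (b ≤? a) cancel mono) w) ⟩
        sum (map (λ b → 𝟙 (b ≤? a)) w)          ≡⟨ length-filter-𝟙 (_≤? a) w ⟨
        length (filter (_≤? a) w)               ∎
        where open ≡-Reasoning

    -- Ranks depend only on the comparisons `b ≤ a`, which `f` preserves and reflects. The case in
    -- use is the shift by a constant.
    red-map : ∀ w → red (map f w) ≡ red w
    red-map w = trans (sym (map-∘ w)) (map-cong (λ a → rank-map a w) w)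

    ∑ₛ-map : ∀ j (g : Word → ℕ) σ → ∑ₛ j g (map f σ) ≡ ∑ₛ j (g ∘ map f) σ
    ∑ₛ-map zero    g σ       = refl
    ∑ₛ-map (suc j) g []      = refl
    ∑ₛ-map (suc j) g (a ∷ σ) = cong₂ _+_ (∑ₛ-map j _ σ) (∑ₛ-map (suc j) g σ)

    occr-map : ∀ τ σ → occr τ (map f σ) ≡ occr τ σ
    occr-map τ σ = begin
      occr τ (map f σ)                                    ≡⟨ occr-∑ₛ τ (map f σ) ⟩
      ∑ₛ (length τ) (λ w → 𝟙 (red w ≟ʷ τ)) (map f σ)      ≡⟨ ∑ₛ-map (length τ) _ σ ⟩
      ∑ₛ (length τ) (λ w → 𝟙 (red (map f w) ≟ʷ τ)) σ
        ≡⟨ ∑ₛ-cong (length τ) (All.universal {P = λ _ → ⊤} (λ _ → tt) σ)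
             (λ {u} _ _ → cong (λ w → 𝟙 (w ≟ʷ τ)) (red-map u)) ⟩
      ∑ₛ (length τ) (λ w → 𝟙 (red w ≟ʷ τ)) σ              ≡⟨ occr-∑ₛ τ σ ⟨
      occr τ σ                                            ∎
      where open ≡-Reasoning

  -- Occurrences in a word L m R with R < L < m

  -- The new entry is counted in no rank but its own, and its own rank counts the whole word.
  red-∷ʳ-max : ∀ {u m} → All (_< m) u → red (u ++ [ m ]) ≡ red u ++ [ suc (length u) ]
  red-∷ʳ-max {u} {m} u<m = begin
    map rank (u ++ [ m ])            ≡⟨ map-++ rank u [ m ] ⟩
    map rank u ++ [ rank m ]         ≡⟨ cong₂ (λ v k → v ++ [ k ]) (map-cong-local (All.map below u<m)) top ⟩
    red u ++ [ suc (length u) ]      ∎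
    where
    open ≡-Reasoning
    rank = λ a → length (filter (_≤? a) (u ++ [ m ]))
    below : ∀ {a} → a < m → rank a ≡ length (filter (_≤? a) u)
    below {a} a<m = cong length (trans (filter-++ (_≤? a) u [ m ])
      (trans (cong (filter (_≤? a) u ++_) (filter-none (_≤? a) (<⇒≱ a<m ∷ []))) (++-identityʳ _)))
    top : rank m ≡ suc (length u)
    top = trans (cong length (trans (filter-++ (_≤? m) u [ m ])
      (cong₂ _++_ (filter-all (_≤? m) (All.map <⇒≤ u<m)) (filter-all (_≤? m) (≤-refl {m} ∷ [])))))
      (trans (length-++ u) (+-comm _ 1))

  -- The new entry is counted in every rank, which explains the `map suc`; its own rank counts only
  -- itself.
  red-∷ʳ-min : ∀ {u c} → All (c <_) u → red (u ++ [ c ]) ≡ map suc (red u) ++ [ 1 ]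
  red-∷ʳ-min {u} {c} c<u = begin
    map rank (u ++ [ c ])            ≡⟨ map-++ rank u [ c ] ⟩
    map rank u ++ [ rank c ]
      ≡⟨ cong₂ (λ v k → v ++ [ k ]) (trans (map-cong-local (All.map above c<u)) (map-∘ u)) bottom ⟩
    map suc (red u) ++ [ 1 ]         ∎
    where
    open ≡-Reasoning
    rank = λ a → length (filter (_≤? a) (u ++ [ c ]))
    above : ∀ {a} → c < a → rank a ≡ suc (length (filter (_≤? a) u))
    above {a} c<a = trans (cong length (trans (filter-++ (_≤? a) u [ c ])
      (cong (filter (_≤? a) u ++_) (filter-all (_≤? a) (<⇒≤ c<a ∷ [])))))
      (trans (length-++ (filter (_≤? a) u)) (+-comm _ 1))
    bottom : rank c ≡ 1
    bottom = cong length (trans (filter-++ (_≤? c) u [ c ])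
      (cong₂ _++_ (filter-none (_≤? c) (All.map <⇒≱ c<u)) (filter-all (_≤? c) (≤-refl {c} ∷ []))))

  red-∷-max : ∀ {v m} → All (_< m) v → red (m ∷ v) ≡ suc (length v) ∷ red v
  red-∷-max {v} {m} v<m = cong₂ _∷_
    (cong length (filter-all (_≤? m) (≤-refl ∷ All.map <⇒≤ v<m)))
    (map-cong-local (All.map below v<m))
    where
    below : ∀ {a} → a < m → length (filter (_≤? a) (m ∷ v)) ≡ length (filter (_≤? a) v)
    below {a} a<m = cong length (trans (filter-++ (_≤? a) [ m ] v)
      (cong (_++ filter (_≤? a) v) (filter-none (_≤? a) (<⇒≱ a<m ∷ []))))

  red-[_] : ∀ a → red [ a ] ≡ [ 1 ]
  red-[ a ] = red-∷-max {[]} {a} []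

  module _ {L R m} (L<m : All (_< m) L) (R<m : All (_< m) R) (R<L : All (λ a → All (_< a) R) L) where

    private
      l = length L
      r = length R

      -- The hypotheses are indexed by the letters of `u`, but the sum that extends `u` at its end
      -- runs over `R`, so each `c` in `R` must be compared with all of `u`.
      All-swap : ∀ {u} → All (λ a → All (_< a) R) u → All (λ c → All (c <_) u) R
      All-swap []         = All.universal (λ _ → []) R
      All-swap (R<a ∷ ps) = All.zipWith (λ (p , q) → p ∷ q) (R<a , All-swap ps)

      R<La : All (λ a → a < m × All (_< a) R) L
      R<La = All.zip (L<m , R<L)

      red-am : ∀ {a} → a < m → red (a ∷ m ∷ []) ≡ 1 ∷ 2 ∷ []
      red-am {a} a<m = trans (red-∷ʳ-max (a<m ∷ [])) (cong (_++ [ 2 ]) red-[ a ])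

      red-ac : ∀ {a c} → c < a → red (a ∷ c ∷ []) ≡ 2 ∷ 1 ∷ []
      red-ac {a} c<a = trans (red-∷ʳ-min (c<a ∷ [])) (cong (λ w → map suc w ++ [ 1 ]) red-[ a ])

      red-amc : ∀ {a c} → a < m → c < a → red (a ∷ m ∷ c ∷ []) ≡ 2 ∷ 3 ∷ 1 ∷ []
      red-amc a<m c<a = trans (red-∷ʳ-min (c<a ∷ <-trans c<a a<m ∷ []))
                              (cong (λ w → map suc w ++ [ 1 ]) (red-am a<m))

      ∑ₛ₁-const-on : ∀ {P : ℕ → Set} {f σ c} → All P σ → (∀ {a} → P a → f [ a ] ≡ c) →
                     ∑ₛ 1 f σ ≡ length σ * c
      ∑ₛ₁-const-on {σ = σ} {c} ps f≡c =
        trans (∑ₛ-cong 1 ps λ { {_ ∷ []} refl (p ∷ []) → f≡c p }) (∑ₛ₁-const c σ)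

    -- Beyond the pairs inside `L` or `R`, each letter of `L` forms a 12 with `m` and a 21 with
    -- every entry of `R`, and so does `m` form a 21 with every entry of `R`. Keeping `g` arbitrary
    -- treats all patterns at once.
    ∑ₛ₂-red : ∀ g → ∑ₛ 2 (g ∘ red) (L ++ m ∷ R) ≡
      ∑ₛ 2 (g ∘ red) L + l * (g (1 ∷ 2 ∷ []) + r * g (2 ∷ 1 ∷ []))
        + (r * g (2 ∷ 1 ∷ []) + ∑ₛ 2 (g ∘ red) R)
    ∑ₛ₂-red g = trans (∑ₛ-++₂ (g ∘ red) L (m ∷ R))
      (cong₂ (λ x y → ∑ₛ 2 (g ∘ red) L + x + (y + ∑ₛ 2 (g ∘ red) R))
        (∑ₛ₁-const-on R<La λ (a<m , R<a) →
          cong₂ _+_ (cong g (red-am a<m)) (∑ₛ₁-const-on R<a (cong g ∘ red-ac)))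
        (∑ₛ₁-const-on R<m (cong g ∘ red-ac)))

    -- A pair from `L` is completed by the larger `m` or by one of `r` smaller entries; a letter of
    -- `L` precedes `m` and a smaller entry, or a pair of `R` lying below it; `m` likewise precedes
    -- a pair of `R`. The last two cases put a 3 in front of the pattern of the pair.
    ∑ₛ₃-red : ∀ g → ∑ₛ 3 (g ∘ red) (L ++ m ∷ R) ≡
      ∑ₛ 3 (g ∘ red) L
        + (∑ₛ 2 (λ u → g (red u ++ [ 3 ])) L + r * ∑ₛ 2 (λ u → g (map suc (red u) ++ [ 1 ])) L)
        + l * (r * g (2 ∷ 3 ∷ 1 ∷ []) + ∑ₛ 2 (λ v → g (3 ∷ red v)) R)
        + (∑ₛ 2 (λ v → g (3 ∷ red v)) R + ∑ₛ 3 (g ∘ red) R)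
    ∑ₛ₃-red g = trans (∑ₛ-++₃ (g ∘ red) L (m ∷ R))
      (cong₂ _+_
        (cong₂ (λ x y → ∑ₛ 3 (g ∘ red) L + x + y)
          -- The inner sum over `m ∷ R` unfolds to the term for `m` plus the sum over `R`.
          (trans (∑ₛ-cong 2 R<La λ { {u} eq ps → cong₂ _+_ (max-last eq (All.map (λ (p , _) → p) ps))
                                                           (min-last (All.map (λ (_ , q) → q) ps)) })
            (trans (∑ₛ-+ 2 _ _ L) (cong (_ +_) (∑ₛ-* 2 r _ L))))
          (∑ₛ₁-const-on R<La λ (a<m , R<a) →
            cong₂ _+_ (∑ₛ₁-const-on R<a (cong g ∘ red-amc a<m)) (∑ₛ-cong 2 R<a max-first)))
        (cong (_+ ∑ₛ 3 (g ∘ red) R) (∑ₛ-cong 2 R<m max-first)))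
      where
      max-last : ∀ {u} → length u ≡ 2 → All (_< m) u → g (red (u ++ [ m ])) ≡ g (red u ++ [ 3 ])
      max-last {u} eq u<m = cong g (trans (red-∷ʳ-max u<m) (cong (λ k → red u ++ [ suc k ]) eq))
      min-last : ∀ {u} → All (λ a → All (_< a) R) u →
                 ∑ₛ 1 (λ v → g (red (u ++ v))) R ≡ r * g (map suc (red u) ++ [ 1 ])
      min-last R<u = ∑ₛ₁-const-on (All-swap R<u) (cong g ∘ red-∷ʳ-min)
      max-first : ∀ {a v} → length v ≡ 2 → All (_< a) v → g (red (a ∷ v)) ≡ g (3 ∷ red v)
      max-first {v = v} eq v<a = cong g (trans (red-∷-max v<a) (cong (λ k → suc k ∷ red v) eq))

  -- `F` stands for how the pattern of a pair grows when a third letter is added. As `red` keeps the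
  -- length, it is enough to test `F` on two arbitrary letters; in every use the added letter
  -- already clashes with `τ`.
  ∑ₛ₂-none : ∀ (F : Word → Word) τ σ → (∀ x y → F (x ∷ y ∷ []) ≢ τ) →
             ∑ₛ 2 (λ u → 𝟙 (F (red u) ≟ʷ τ)) σ ≡ 0
  ∑ₛ₂-none F τ σ F≢τ = trans
    (∑ₛ-cong 2 (All.universal {P = λ _ → ⊤} (λ _ → tt) σ)
      λ { {x ∷ y ∷ []} refl _ → cong (if_then 1 else 0) (dec-false (F _ ≟ʷ τ) (F≢τ _ _)) })
    (∑ₛ-zero 2 σ)

  ∑ₛ₂-occr : ∀ (F : Word → Word) p q σ →
             (∀ {x y} → F (x ∷ y ∷ []) ≡ F (p ∷ q ∷ []) → x ∷ y ∷ [] ≡ p ∷ q ∷ []) →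
             ∑ₛ 2 (λ u → 𝟙 (F (red u) ≟ʷ F (p ∷ q ∷ []))) σ ≡ occr (p ∷ q ∷ []) σ
  ∑ₛ₂-occr F p q σ F-inj = trans
    (∑ₛ-cong 2 (All.universal {P = λ _ → ⊤} (λ _ → tt) σ)
      λ { {x ∷ y ∷ []} refl _ → 𝟙-cong (F _ ≟ʷ _) (_ ≟ʷ _) F-inj (cong F) })
    (sym (occr-∑ₛ (p ∷ q ∷ []) σ))

  module _ {L R m} (L<m : All (_< m) L) (R<m : All (_< m) R) (R<L : All (λ a → All (_< a) R) L) where

    private
      l = length L
      r = length R
      σ = L ++ m ∷ R

    occr₂ : ∀ p q → occr (p ∷ q ∷ []) σ ≡
      occr (p ∷ q ∷ []) L + l * (𝟙 (1 ∷ 2 ∷ [] ≟ʷ p ∷ q ∷ []) + r * 𝟙 (2 ∷ 1 ∷ [] ≟ʷ p ∷ q ∷ []))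
        + (r * 𝟙 (2 ∷ 1 ∷ [] ≟ʷ p ∷ q ∷ []) + occr (p ∷ q ∷ []) R)
    occr₂ p q = begin
      occr τ σ      ≡⟨ occr-∑ₛ τ σ ⟩
      ∑ₛ 2 (g ∘ red) σ ≡⟨ ∑ₛ₂-red L<m R<m R<L g ⟩
      _             ≡⟨ cong₂ (λ x y → x + l * (g (1 ∷ 2 ∷ []) + β) + (β + y)) (occr-∑ₛ τ L) (occr-∑ₛ τ R) ⟨
      _             ∎
      where
      open ≡-Reasoning
      τ = p ∷ q ∷ []
      g : Word → ℕ
      g w = 𝟙 (w ≟ʷ τ)
      β = r * g (2 ∷ 1 ∷ [])

    -- `α` belongs to pairs of `L` followed by `m`, `β` to pairs of `L` followed by an entry of `R`,
    -- and `γ` to pairs of `R` preceded by a larger letter. For each pattern they are supplied as 0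
    -- or as a count of 12 or 21.
    occr₃ : ∀ p q s {α β γ} → let τ = p ∷ q ∷ s ∷ [] in
      ∑ₛ 2 (λ u → 𝟙 (red u ++ [ 3 ] ≟ʷ τ)) L ≡ α →
      ∑ₛ 2 (λ u → 𝟙 (map suc (red u) ++ [ 1 ] ≟ʷ τ)) L ≡ β →
      ∑ₛ 2 (λ v → 𝟙 (3 ∷ red v ≟ʷ τ)) R ≡ γ →
      occr τ σ ≡ occr τ L + (α + r * β) + l * (r * 𝟙 (2 ∷ 3 ∷ 1 ∷ [] ≟ʷ τ) + γ) + (γ + occr τ R)
    occr₃ p q s refl refl refl = begin
      occr τ σ      ≡⟨ occr-∑ₛ τ σ ⟩
      ∑ₛ 3 (g ∘ red) σ ≡⟨ ∑ₛ₃-red L<m R<m R<L g ⟩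
      _             ≡⟨ cong₂ (λ x y → x + α + l * β + (γ + y)) (occr-∑ₛ τ L) (occr-∑ₛ τ R) ⟨
      _             ∎
      where
      open ≡-Reasoning
      τ = p ∷ q ∷ s ∷ []
      g : Word → ℕ
      g w = 𝟙 (w ≟ʷ τ)
      α = ∑ₛ 2 (λ u → g (red u ++ [ 3 ])) L + r * ∑ₛ 2 (λ u → g (map suc (red u) ++ [ 1 ])) L
      γ = ∑ₛ 2 (λ v → g (3 ∷ red v)) R
      β = r * g (2 ∷ 3 ∷ 1 ∷ []) + γ

    -- A triple that is not inside one part ends in its maximum, ends in its minimum or starts with
    -- its maximum; 132 does none of these.
    occr-132 : occr (1 ∷ 3 ∷ 2 ∷ []) σ ≡ occr (1 ∷ 3 ∷ 2 ∷ []) L + occr (1 ∷ 3 ∷ 2 ∷ []) R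
    occr-132 = trans
      (occr₃ 1 3 2
        (∑ₛ₂-none (_++ [ 3 ]) _ L λ _ _ ())
        (∑ₛ₂-none (λ w → map suc w ++ [ 1 ]) _ L λ _ _ ())
        (∑ₛ₂-none (3 ∷_) (1 ∷ 3 ∷ 2 ∷ []) R λ _ _ ()))
      (solve 4 (λ o l r o′ →
          o :+ (con 0 :+ r :* con 0) :+ l :* (r :* con 0 :+ con 0) :+ (con 0 :+ o′)
            := o :+ o′) refl
        (occr (1 ∷ 3 ∷ 2 ∷ []) L) l r _)

  red-∷-min : ∀ {v c} → All (c <_) v → red (c ∷ v) ≡ 1 ∷ map suc (red v)
  red-∷-min {v} {c} c<v = cong₂ _∷_
    (cong length (trans (filter-++ (_≤? c) [ c ] v)
      (cong₂ _++_ (filter-all (_≤? c) (≤-refl {c} ∷ [])) (filter-none (_≤? c) (All.map <⇒≱ c<v)))))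
    (trans (map-cong-local (All.map above c<v)) (map-∘ v))
    where
    above : ∀ {a} → c < a → length (filter (_≤? a) (c ∷ v)) ≡ suc (length (filter (_≤? a) v))
    above {a} c<a = cong length (trans (filter-++ (_≤? a) [ c ] v)
      (cong (_++ filter (_≤? a) v) (filter-all (_≤? a) (<⇒≤ c<a ∷ []))))

  -- This covers an order of letters that `R < L < m` excludes; it exhibits the occurrence that
  -- avoidance forbids.
  red-132 : ∀ {a b c} → a < c → c < b → red (a ∷ b ∷ c ∷ []) ≡ 1 ∷ 3 ∷ 2 ∷ []
  red-132 {c = c} a<c c<b = trans (red-∷-min (<-trans a<c c<b ∷ a<c ∷ []))
    (cong (λ w → 1 ∷ map suc w) (trans (red-∷-max (c<b ∷ [])) (cong (2 ∷_) red-[ c ])))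

  -- Lists without repetition

  module _ {a} {A : Set a} where

    Unique-++⁻ : ∀ xs {ys : List A} → Unique (xs ++ ys) → Unique xs × Unique ys × Disjoint xs ys
    Unique-++⁻ []       u        = [] , u , λ ()
    Unique-++⁻ (x ∷ xs) (x∉ ∷ u) with Unique-++⁻ xs u | All.++⁻ xs x∉
    ... | uxs , uys , disj | x∉xs , x∉ys = x∉xs ∷ uxs , uys , λ
      { (here refl , ∈ys) → All.lookup x∉ys ∈ys refl
      ; (there ∈xs , ∈ys) → disj (∈xs , ∈ys) }

    -- Pigeonhole principle, by induction: deleting one `x` from `ys` keeps every other member of
    -- the list, because `x` does not recur in `xs`.
    Unique-length-≤ : ∀ {xs ys : List A} → Unique xs → All (_∈ ys) xs → length xs ≤ length ys
    Unique-length-≤ []       []        = z≤n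
    Unique-length-≤ {x ∷ xs} (x∉ ∷ u) (x∈ys ∷ ps) with ∈-∃++ x∈ys
    ... | as , bs , refl = subst (suc (length xs) ≤_) (sym len) (s≤s (Unique-length-≤ u (All.tabulate other)))
      where
      len : length (as ++ x ∷ bs) ≡ suc (length (as ++ bs))
      len = trans (length-++ as) (trans (+-suc (length as) _) (cong suc (sym (length-++ as))))
      other : ∀ {y} → y ∈ xs → y ∈ as ++ bs
      other y∈xs with ∈-++⁻ as (All.lookup ps y∈xs)
      ... | inj₁ y∈as         = ∈-++⁺ˡ y∈as
      ... | inj₂ (here refl)  = contradiction refl (All.lookup x∉ y∈xs)
      ... | inj₂ (there y∈bs) = ∈-++⁺ʳ as y∈bs

    -- Injectivity is asked only on members because `glue` is injective on pairs of permutations,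
    -- but not on arbitrary pairs of words.
    Unique-map⁺-local : ∀ {b} {B : Set b} {f : A → B} {xs} →
      (∀ {x y} → x ∈ xs → y ∈ xs → f x ≡ f y → x ≡ y) → Unique xs → Unique (map f xs)
    Unique-map⁺-local inj []       = []
    Unique-map⁺-local inj (x∉ ∷ u) =
      All.map⁺ (All.tabulate λ y∈ eq → All.lookup x∉ y∈ (inj (here refl) (there y∈) eq))
        ∷ Unique-map⁺-local (λ x∈ y∈ → inj (there x∈) (there y∈)) u

    -- Both prefixes end where `x` occurs for the first time.
    split-unique : ∀ {x} xs xs′ {ys ys′ : List A} → x ∉ xs → x ∉ xs′ →
                   xs ++ x ∷ ys ≡ xs′ ++ x ∷ ys′ → xs ≡ xs′ × ys ≡ ys′
    split-unique []       []         _ _ refl = refl , refl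
    split-unique []       (_ ∷ _)    _ x∉ eq  = contradiction (here (proj₁ (∷-injective eq))) x∉
    split-unique (_ ∷ _)  []         x∉ _ eq  = contradiction (here (sym (proj₁ (∷-injective eq)))) x∉
    split-unique (_ ∷ xs) (_ ∷ xs′) x∉ x∉′ eq with ∷-injective eq
    ... | refl , eq′ with split-unique xs xs′ (x∉ ∘ there) (x∉′ ∘ there) eq′
    ...   | refl , refl = refl , refl

  -- Decomposition of 132-avoiding permutations

  ∈-[1⋯]⁺ : ∀ {n x} → 1 ≤ x → x ≤ n → x ∈ [1⋯ n ]
  ∈-[1⋯]⁺ (s≤s _) x≤n = ∈-map⁺ suc (∈-upTo⁺ x≤n)

  ∈-[1⋯]⁻ : ∀ {n x} → x ∈ [1⋯ n ] → 1 ≤ x × x ≤ n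
  ∈-[1⋯]⁻ x∈ with ∈-map⁻ suc x∈
  ... | _ , i∈ , refl = s≤s z≤n , ∈-upTo⁻ i∈

  -- Pigeonhole against the `n ∸ b` values of the interval, listed as a shift of `[1⋯ n ∸ b ]`. It
  -- later turns order relations between the parts into bounds on their entries.
  Unique-interval : ∀ {b n xs} → Unique xs → b ≤ n → All (λ x → b < x × x ≤ n) xs → b + length xs ≤ n
  Unique-interval {b} {n} {xs} u b≤n ps = begin
    b + length xs                           ≤⟨ +-monoʳ-≤ b (Unique-length-≤ u (All.map member ps)) ⟩
    b + length (map (b +_) [1⋯ n ∸ b ])     ≡⟨ cong (b +_) (length-map _ [1⋯ n ∸ b ]) ⟩
    b + length (map suc (upTo (n ∸ b)))     ≡⟨ cong (b +_) (length-map suc (upTo (n ∸ b))) ⟩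
    b + length (upTo (n ∸ b))               ≡⟨ cong (b +_) (length-upTo (n ∸ b)) ⟩
    b + (n ∸ b)                             ≡⟨ m+[n∸m]≡n b≤n ⟩
    n                                       ∎
    where
    open ≤-Reasoning
    member : ∀ {x} → b < x × x ≤ n → x ∈ map (b +_) [1⋯ n ∸ b ]
    member {x} (b<x , x≤n) = subst (_∈ map (b +_) [1⋯ n ∸ b ]) (m+[n∸m]≡n (<⇒≤ b<x))
      (∈-map⁺ (b +_) (∈-[1⋯]⁺ (m<n⇒0<n∸m b<x) (∸-monoˡ-≤ b x≤n)))

  ∈-words⁺ : ∀ {as σ} → All (_∈ as) σ → σ ∈ words as (length σ)
  ∈-words⁺ []       = here refl
  ∈-words⁺ (p ∷ ps) = ∈-cartesianProductWith⁺ _∷_ p (∈-words⁺ ps)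

  ∈-words⁻ : ∀ {as σ} m → σ ∈ words as m → length σ ≡ m × All (_∈ as) σ
  ∈-words⁻ zero    (here refl) = refl , []
  ∈-words⁻ {as} (suc m) σ∈ with ∈-cartesianProductWith⁻ _∷_ as (words as m) σ∈
  ... | a , τ , a∈ , τ∈ , refl with ∈-words⁻ m τ∈
  ...   | refl , ps = refl , a∈ ∷ ps

  words-unique : ∀ {as} m → Unique as → Unique (words as m)
  words-unique zero    u = [] ∷ []
  words-unique (suc m) u = Unique.cartesianProductWith⁺ _∷_ ∷-injective u (words-unique m u)

  -- The length of the word takes the place of `n`. Distinct entries from 1 to the length fill this
  -- whole range by the pigeonhole principle.
  IsPermutation : Word → Set
  IsPermutation σ = Unique σ × All (λ x → 1 ≤ x × x ≤ length σ) σ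

  132-avoiding : Word → Set
  132-avoiding σ = occr (1 ∷ 3 ∷ 2 ∷ []) σ ≡ 0

  𝒮₁₃₂ : ℕ → List Word
  𝒮₁₃₂ n = 𝒮-avoiding n (1 ∷ 3 ∷ 2 ∷ [])

  ∈-𝒮₁₃₂⁺ : ∀ {σ} → IsPermutation σ → 132-avoiding σ → σ ∈ 𝒮₁₃₂ (length σ)
  ∈-𝒮₁₃₂⁺ (u , ps) av = ∈-filter⁺ _ (∈-filter⁺ (unique? _≟_) (∈-words⁺ (All.map (uncurry ∈-[1⋯]⁺) ps)) u) av

  ∈-𝒮₁₃₂⁻ : ∀ {n σ} → σ ∈ 𝒮₁₃₂ n → length σ ≡ n × IsPermutation σ × 132-avoiding σ
  ∈-𝒮₁₃₂⁻ {n} σ∈ with ∈-filter⁻ (λ σ → occr (1 ∷ 3 ∷ 2 ∷ []) σ ≟ 0) {xs = 𝒮 n} σ∈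
  ... | σ∈𝒮 , av with ∈-filter⁻ (unique? _≟_) {xs = words [1⋯ n ] n} σ∈𝒮
  ...   | σ∈w , u with ∈-words⁻ n σ∈w
  ...     | refl , ps = refl , (u , All.map ∈-[1⋯]⁻ ps) , av

  𝒮₁₃₂-unique : ∀ n → Unique (𝒮₁₃₂ n)
  𝒮₁₃₂-unique n = Unique.filter⁺ _ (Unique.filter⁺ (unique? _≟_)
    (words-unique n (Unique.map⁺ suc-injective (Unique.upTo⁺ n))))

  -- Gluing two permutations around a new largest entry

  glue : Word → Word → Word
  glue L R = map (length R +_) L ++ suc (length L + length R) ∷ R

  module Glue {L R} (permL : IsPermutation L) (permR : IsPermutation R) where

    private
      l = length L
      r = length R
      L⁺ = map (r +_) L
      uL = proj₁ permL
      pL = proj₂ permL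
      uR = proj₁ permR
      pR = proj₂ permR

    L<max : All (_< suc (l + r)) L⁺
    L<max = All.map⁺ (All.map (λ (_ , x≤l) → s≤s (≤-trans (+-monoʳ-≤ r x≤l) (≤-reflexive (+-comm r l)))) pL)

    R<max : All (_< suc (l + r)) R
    R<max = All.map (λ (_ , x≤r) → s≤s (≤-trans x≤r (m≤n+m r l))) pR

    -- Entries of `L` are at least 1, so the shift by `r` lifts them above all of `R`.
    R<L : All (λ a → All (_< a) R) L⁺
    R<L = All.map⁺ (All.map (λ (1≤a , _) → All.map (λ (_ , c≤r) → ≤-<-trans c≤r (m<m+n r 1≤a)) pR) pL)

    length-glue : length (glue L R) ≡ suc (l + r)
    length-glue = trans (length-++ L⁺) (trans (cong (_+ suc r) (length-map _ L)) (+-suc l r))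

    glue-isPermutation : IsPermutation (glue L R)
    glue-isPermutation =
      Unique.++⁺ (Unique.map⁺ (+-cancelˡ-≡ r _ _) uL) (All.map (λ x<m → <⇒≢ x<m ∘ sym) R<max ∷ uR)
        (λ { (∈L , here refl) → <-irrefl refl (All.lookup L<max ∈L)
           ; (∈L , there ∈R) → <-irrefl refl (All.lookup (All.lookup R<L ∈L) ∈R) }) ,
      subst (λ n → All (λ x → 1 ≤ x × x ≤ n) (glue L R)) (sym length-glue)
        (All.++⁺ (All.zipWith (λ (p , q) → p , <⇒≤ q)
                   (All.map⁺ (All.map (λ (1≤x , _) → ≤-trans 1≤x (m≤n+m _ r)) pL) , L<max))
                 ((s≤s z≤n , ≤-refl) ∷ All.zipWith (λ ((1≤x , _) , q) → 1≤x , <⇒≤ q) (pR , R<max)))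

    occr-L⁺ : ∀ τ → occr τ L⁺ ≡ occr τ L
    occr-L⁺ τ = occr-map (+-monoʳ-≤ r) (+-cancelˡ-≤ r _ _) τ L

    glue-avoiding : 132-avoiding L → 132-avoiding R → 132-avoiding (glue L R)
    glue-avoiding avL avR =
      trans (occr-132 L<max R<max R<L) (cong₂ _+_ (trans (occr-L⁺ (1 ∷ 3 ∷ 2 ∷ [])) avL) avR)

    private
      ∑ₛ₂-occr-L⁺ : ∀ (F : Word → Word) p q →
                    (∀ {x y} → F (x ∷ y ∷ []) ≡ F (p ∷ q ∷ []) → x ∷ y ∷ [] ≡ p ∷ q ∷ []) →
                    ∑ₛ 2 (λ u → 𝟙 (F (red u) ≟ʷ F (p ∷ q ∷ []))) L⁺ ≡ occr (p ∷ q ∷ []) L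
      ∑ₛ₂-occr-L⁺ F p q F-inj = trans (∑ₛ₂-occr F p q L⁺ F-inj) (occr-L⁺ (p ∷ q ∷ []))

      occr-glue₂ : ∀ p q → let τ = p ∷ q ∷ [] in occr τ (glue L R) ≡
        occr τ L + l * (𝟙 (1 ∷ 2 ∷ [] ≟ʷ τ) + r * 𝟙 (2 ∷ 1 ∷ [] ≟ʷ τ)) + (r * 𝟙 (2 ∷ 1 ∷ [] ≟ʷ τ) + occr τ R)
      occr-glue₂ p q = trans (occr₂ L<max R<max R<L p q)
        (cong₂ (λ o k → o + k * β + γ) (occr-L⁺ τ) (length-map _ L))
        where
        τ = p ∷ q ∷ []
        β = 𝟙 (1 ∷ 2 ∷ [] ≟ʷ τ) + r * 𝟙 (2 ∷ 1 ∷ [] ≟ʷ τ)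
        γ = r * 𝟙 (2 ∷ 1 ∷ [] ≟ʷ τ) + occr τ R

      occr-glue₃ : ∀ p q s {α β γ} → let τ = p ∷ q ∷ s ∷ [] in
        ∑ₛ 2 (λ u → 𝟙 (red u ++ [ 3 ] ≟ʷ τ)) L⁺ ≡ α →
        ∑ₛ 2 (λ u → 𝟙 (map suc (red u) ++ [ 1 ] ≟ʷ τ)) L⁺ ≡ β →
        ∑ₛ 2 (λ v → 𝟙 (3 ∷ red v ≟ʷ τ)) R ≡ γ →
        occr τ (glue L R) ≡ occr τ L + (α + r * β) + l * (r * 𝟙 (2 ∷ 3 ∷ 1 ∷ [] ≟ʷ τ) + γ) + (γ + occr τ R)
      occr-glue₃ p q s {α} {β} {γ} eqα eqβ eqγ = trans (occr₃ L<max R<max R<L p q s eqα eqβ eqγ)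
        (cong₂ (λ o k → o + (α + r * β) + k * (r * 𝟙 (2 ∷ 3 ∷ 1 ∷ [] ≟ʷ τ) + γ) + (γ + occr τ R))
          (occr-L⁺ τ) (length-map _ L))
        where
        τ = p ∷ q ∷ s ∷ []

    -- Each of the `l` letters of `L` forms a 12 with the maximum; no 12 leads from `L` or the
    -- maximum into `R`.
    occr-glue-12 : occr (1 ∷ 2 ∷ []) (glue L R) ≡ l + occr (1 ∷ 2 ∷ []) L + occr (1 ∷ 2 ∷ []) R
    occr-glue-12 = trans (occr-glue₂ 1 2)
      (solve 4 (λ o l r o′ →
          o :+ l :* (con 1 :+ r :* con 0) :+ (r :* con 0 :+ o′)
            := l :+ o :+ o′) refl
        (occr (1 ∷ 2 ∷ []) L) l r _)

    -- The letters of `L` and the maximum, `suc l` in all, stand before and above all `r` entries of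
    -- `R`.
    occr-glue-21 : occr (2 ∷ 1 ∷ []) (glue L R) ≡ suc l * r + occr (2 ∷ 1 ∷ []) L + occr (2 ∷ 1 ∷ []) R
    occr-glue-21 = trans (occr-glue₂ 2 1)
      (solve 4 (λ o l r o′ →
          o :+ l :* (con 0 :+ r :* con 1) :+ (r :* con 1 :+ o′)
            := (con 1 :+ l) :* r :+ o :+ o′) refl
        (occr (2 ∷ 1 ∷ []) L) l r _)

    occr-glue-123 : occr (1 ∷ 2 ∷ 3 ∷ []) (glue L R) ≡
      occr (1 ∷ 2 ∷ 3 ∷ []) L + occr (1 ∷ 2 ∷ []) L + occr (1 ∷ 2 ∷ 3 ∷ []) R
    occr-glue-123 = trans
      (occr-glue₃ 1 2 3
        (∑ₛ₂-occr-L⁺ (_++ [ 3 ]) 1 2 λ { refl → refl })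
        (∑ₛ₂-none (λ w → map suc w ++ [ 1 ]) _ L⁺ λ _ _ ())
        (∑ₛ₂-none (3 ∷_) (1 ∷ 2 ∷ 3 ∷ []) R λ _ _ ()))
      (solve 5 (λ o t l r o′ →
          o :+ (t :+ r :* con 0) :+ l :* (r :* con 0 :+ con 0) :+ (con 0 :+ o′)
            := o :+ t :+ o′) refl
        (occr (1 ∷ 2 ∷ 3 ∷ []) L) (occr (1 ∷ 2 ∷ []) L) l r _)

    occr-glue-213 : occr (2 ∷ 1 ∷ 3 ∷ []) (glue L R) ≡
      occr (2 ∷ 1 ∷ 3 ∷ []) L + occr (2 ∷ 1 ∷ []) L + occr (2 ∷ 1 ∷ 3 ∷ []) R
    occr-glue-213 = trans
      (occr-glue₃ 2 1 3
        (∑ₛ₂-occr-L⁺ (_++ [ 3 ]) 2 1 λ { refl → refl })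
        (∑ₛ₂-none (λ w → map suc w ++ [ 1 ]) _ L⁺ λ _ _ ())
        (∑ₛ₂-none (3 ∷_) (2 ∷ 1 ∷ 3 ∷ []) R λ _ _ ()))
      (solve 5 (λ o t l r o′ →
          o :+ (t :+ r :* con 0) :+ l :* (r :* con 0 :+ con 0) :+ (con 0 :+ o′)
            := o :+ t :+ o′) refl
        (occr (2 ∷ 1 ∷ 3 ∷ []) L) (occr (2 ∷ 1 ∷ []) L) l r _)

    -- A mixed 231 has its 1 in `R`. Its 23 is a letter of `L` with the maximum, giving `l * r`, or
    -- a 12 of `L`, giving the term linear in that count.
    occr-glue-231 : occr (2 ∷ 3 ∷ 1 ∷ []) (glue L R) ≡
      l * r + (occr (2 ∷ 3 ∷ 1 ∷ []) L + r * occr (1 ∷ 2 ∷ []) L) + occr (2 ∷ 3 ∷ 1 ∷ []) R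
    occr-glue-231 = trans
      (occr-glue₃ 2 3 1
        (∑ₛ₂-none (_++ [ 3 ]) _ L⁺ λ _ _ ())
        (∑ₛ₂-occr-L⁺ (λ w → map suc w ++ [ 1 ]) 1 2 λ { refl → refl })
        (∑ₛ₂-none (3 ∷_) (2 ∷ 3 ∷ 1 ∷ []) R λ _ _ ()))
      (solve 5 (λ o t l r o′ →
          o :+ (con 0 :+ r :* t) :+ l :* (r :* con 1 :+ con 0) :+ (con 0 :+ o′)
            := l :* r :+ (o :+ r :* t) :+ o′) refl
        (occr (2 ∷ 3 ∷ 1 ∷ []) L) (occr (1 ∷ 2 ∷ []) L) l r _)

    -- The 3 of a mixed 312 is one of the `suc l` letters before `R`, and its 12 lies in `R`.
    occr-glue-312 : occr (3 ∷ 1 ∷ 2 ∷ []) (glue L R) ≡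
      occr (3 ∷ 1 ∷ 2 ∷ []) L + (occr (3 ∷ 1 ∷ 2 ∷ []) R + suc l * occr (1 ∷ 2 ∷ []) R)
    occr-glue-312 = trans
      (occr-glue₃ 3 1 2
        (∑ₛ₂-none (_++ [ 3 ]) _ L⁺ λ _ _ ())
        (∑ₛ₂-none (λ w → map suc w ++ [ 1 ]) _ L⁺ λ _ _ ())
        (∑ₛ₂-occr (3 ∷_) 1 2 R λ { refl → refl }))
      (solve 5 (λ o t l r o′ →
          o :+ (con 0 :+ r :* con 0) :+ l :* (r :* con 0 :+ t) :+ (t :+ o′)
            := o :+ (o′ :+ (con 1 :+ l) :* t)) refl
        (occr (3 ∷ 1 ∷ 2 ∷ []) L) (occr (1 ∷ 2 ∷ []) R) l r _)

    -- A mixed 321 is a 21 of `L` followed by an entry of `R`, or a 21 of `R` preceded by one of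
    -- `suc l` larger letters.
    occr-glue-321 : occr (3 ∷ 2 ∷ 1 ∷ []) (glue L R) ≡
      (occr (3 ∷ 2 ∷ 1 ∷ []) L + r * occr (2 ∷ 1 ∷ []) L) + (occr (3 ∷ 2 ∷ 1 ∷ []) R + suc l * occr (2 ∷ 1 ∷ []) R)
    occr-glue-321 = trans
      (occr-glue₃ 3 2 1
        (∑ₛ₂-none (_++ [ 3 ]) _ L⁺ λ _ _ ())
        (∑ₛ₂-occr-L⁺ (λ w → map suc w ++ [ 1 ]) 2 1 λ { refl → refl })
        (∑ₛ₂-occr (3 ∷_) 2 1 R λ { refl → refl }))
      (solve 6 (λ o t t′ l r o′ →
          o :+ (con 0 :+ r :* t) :+ l :* (r :* con 0 :+ t′) :+ (t′ :+ o′)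
            := (o :+ r :* t) :+ (o′ :+ (con 1 :+ l) :* t′)) refl
        (occr (3 ∷ 2 ∷ 1 ∷ []) L) (occr (2 ∷ 1 ∷ []) L) (occr (2 ∷ 1 ∷ []) R) l r _)

  -- Equal words have equal lengths, hence the same largest letter. It lies in neither shifted left
  -- part, so both words are cut at the same place. The right parts agree, so the shifts agree and
  -- cancel.
  glue-injective : ∀ {L R L′ R′} → IsPermutation L → IsPermutation R → IsPermutation L′ → IsPermutation R′ →
                   glue L R ≡ glue L′ R′ → L ≡ L′ × R ≡ R′
  glue-injective {L} {R} {L′} {R′} pL pR pL′ pR′ eq =
    let eqL⁺ , eqR = split-unique (map (length R +_) L) (map (length R′ +_) L′) max∉L max∉L′
          (subst (λ n → glue L R ≡ map (length R′ +_) L′ ++ suc n ∷ R′) (sym len) eq)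
    in map-injective (+-cancelˡ-≡ (length R) _ _)
         (trans eqL⁺ (cong (λ r → map (r +_) L′) (sym (cong length eqR)))) , eqR
    where
    len : length L + length R ≡ length L′ + length R′
    len = suc-injective (trans (sym (Glue.length-glue pL pR))
      (trans (cong length eq) (Glue.length-glue pL′ pR′)))
    max∉L : suc (length L + length R) ∉ map (length R +_) L
    max∉L m∈ = <-irrefl refl (All.lookup (Glue.L<max pL pR) m∈)
    max∉L′ : suc (length L + length R) ∉ map (length R′ +_) L′
    max∉L′ m∈ = <-irrefl (cong suc len) (All.lookup (Glue.L<max pL′ pR′) m∈)

  -- Cutting a 132-avoiding permutation at its largest entry

  module Unglue {A B} (perm : IsPermutation (A ++ suc (length A + length B) ∷ B))
                (av : 132-avoiding (A ++ suc (length A + length B) ∷ B)) where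

    private
      l = length A
      r = length B
      m = suc (l + r)
      σ = A ++ m ∷ B

      length-σ : length σ ≡ m
      length-σ = trans (length-++ A) (+-suc l r)

      entries : All (λ x → 1 ≤ x × x ≤ m) σ
      entries = subst (λ n → All (λ x → 1 ≤ x × x ≤ n) σ) length-σ (proj₂ perm)

      parts = Unique-++⁻ A (proj₁ perm)

      uA : Unique A
      uA = proj₁ parts

      uB : Unique B
      uB = AllPairs.tail (proj₁ (proj₂ parts))

      pA : ∀ {a} → a ∈ A → 1 ≤ a × a < m
      pA a∈ = let 1≤a , a≤m = All.lookup entries (∈-++⁺ˡ a∈) in
        1≤a , ≤∧≢⇒< a≤m λ { refl → proj₂ (proj₂ parts) (a∈ , here refl) }

      pB : ∀ {b} → b ∈ B → 1 ≤ b × b < m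
      pB b∈ = let 1≤b , b≤m = All.lookup entries (∈-++⁺ʳ A (there b∈)) in
        1≤b , ≤∧≢⇒< b≤m λ { refl → All.lookup (AllPairs.head (proj₁ (proj₂ parts))) b∈ refl }

      -- Distinctness excludes `a ≡ b`, and with `a < b` the letters `a`, `m`, `b` would form a 132.
      B<A : ∀ {a b} → a ∈ A → b ∈ B → b < a
      B<A {a} {b} a∈ b∈ = ≰⇒> λ a≤b →
        contradiction f[amb]≡0 (f[amb]≢0 (≤∧≢⇒< a≤b λ { refl → proj₂ (proj₂ parts) (a∈ , there b∈) }))
        where
        f : Word → ℕ
        f w = 𝟙 (red w ≟ʷ 1 ∷ 3 ∷ 2 ∷ [])
        -- Of the four summands for `A ++ m ∷ B`, this one has one letter in `A` and two in `m ∷ B`;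
        -- a sum of naturals vanishes only if every summand does.
        ∑ₛ≡0 : ∑ₛ 1 (λ u → ∑ₛ 2 (λ v → f (u ++ v)) (m ∷ B)) A ≡ 0
        ∑ₛ≡0 = m+n≡0⇒n≡0 (∑ₛ 3 f A + ∑ₛ 2 (λ u → ∑ₛ 1 (λ v → f (u ++ v)) (m ∷ B)) A)
          (m+n≡0⇒m≡0 _ (trans (sym (trans (occr-∑ₛ (1 ∷ 3 ∷ 2 ∷ []) σ) (∑ₛ-++₃ f A (m ∷ B)))) av))
        f[amb]≡0 : f (a ∷ m ∷ b ∷ []) ≡ 0
        f[amb]≡0 = ∑ₛ₁≡0 {λ v → f (a ∷ m ∷ v)}
          (m+n≡0⇒m≡0 _ (∑ₛ₁≡0 {λ u → ∑ₛ 2 (λ v → f (u ++ v)) (m ∷ B)} ∑ₛ≡0 a∈)) b∈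
        f[amb]≢0 : a < b → f (a ∷ m ∷ b ∷ []) ≢ 0
        f[amb]≢0 a<b f≡0 with trans (sym (cong (λ w → 𝟙 (w ≟ʷ 1 ∷ 3 ∷ 2 ∷ [])) (red-132 a<b (proj₂ (pB b∈))))) f≡0
        ... | ()

      A′ = map (_∸ r) A

      -- The `r` distinct entries of `B` all lie strictly between 0 and `a`.
      r<A : ∀ {a} → a ∈ A → r < a
      r<A {suc a} a∈ = s≤s (Unique-interval uB z≤n (All.tabulate λ b∈ → proj₁ (pB b∈) , ≤-pred (B<A a∈ b∈)))
      r<A {zero}  a∈ = contradiction (proj₁ (pA a∈)) λ ()

      -- The `l` distinct entries of `A` lie above `b` and are at most `l + r`, so `b + l ≤ l + r`.
      B≤r : ∀ {b} → b ∈ B → b ≤ r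
      B≤r {b} b∈ = +-cancelˡ-≤ l b r (≤-trans (≤-reflexive (+-comm l b))
        (Unique-interval uA (≤-pred (proj₂ (pB b∈))) (All.tabulate λ a∈ → B<A a∈ b∈ , ≤-pred (proj₂ (pA a∈)))))

      -- Truncated subtraction loses nothing here, since `r<A` bounds every entry of `A` from below.
      A≡ : map (r +_) A′ ≡ A
      A≡ = trans (sym (map-∘ A)) (trans (map-cong-local (All.tabulate λ a∈ → m+[n∸m]≡n (<⇒≤ (r<A a∈)))) (map-id A))

      perm-A′ : IsPermutation A′
      perm-A′ = Unique.map⁻ (subst Unique (sym A≡) uA) ,
        All.map⁺ (All.tabulate λ {a} a∈ → m<n⇒0<n∸m (r<A a∈) ,
          ≤-trans (m≤n+o⇒m∸n≤o a r (≤-trans (≤-pred (proj₂ (pA a∈))) (≤-reflexive (+-comm l r))))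
                  (≤-reflexive (sym (length-map _ A))))

      perm-B : IsPermutation B
      perm-B = uB , All.tabulate λ b∈ → proj₁ (pB b∈) , B≤r b∈

      glue-A′B : glue A′ B ≡ σ
      glue-A′B = cong₂ (λ L n → L ++ suc (n + r) ∷ B) A≡ (length-map _ A)

      av-parts : occr (1 ∷ 3 ∷ 2 ∷ []) A + occr (1 ∷ 3 ∷ 2 ∷ []) B ≡ 0
      av-parts = trans (sym (occr-132 (All.tabulate (proj₂ ∘ pA)) (All.tabulate (proj₂ ∘ pB))
                               (All.tabulate λ a∈ → All.tabulate (B<A a∈)))) av

    unglue : ∃₂ λ L R → (IsPermutation L × 132-avoiding L) × (IsPermutation R × 132-avoiding R) ×
             A ++ m ∷ B ≡ glue L R
    unglue = A′ , B ,
      (perm-A′ , trans (sym (Glue.occr-L⁺ perm-A′ perm-B (1 ∷ 3 ∷ 2 ∷ [])))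
                        (trans (cong (occr (1 ∷ 3 ∷ 2 ∷ [])) A≡) (m+n≡0⇒m≡0 _ av-parts))) ,
      (perm-B , m+n≡0⇒n≡0 (occr (1 ∷ 3 ∷ 2 ∷ []) A) av-parts) , sym glue-A′B

  -- Otherwise `suc n` distinct entries would fit between 1 and `n`.
  max∈ : ∀ {σ n} → IsPermutation σ → length σ ≡ suc n → suc n ∈ σ
  max∈ {σ} {n} (u , ps) eq with _∈?_ _≟_ (suc n) σ
  ... | yes m∈ = m∈
  ... | no  m∉ = contradiction (Unique-interval {0} {n} u z≤n (All.tabulate bounded)) (<⇒≱ (≤-reflexive (sym eq)))
    where
    bounded : ∀ {x} → x ∈ σ → 0 < x × x ≤ n
    bounded x∈ = let 1≤x , x≤len = All.lookup ps x∈ in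
      1≤x , ≤-pred (≤∧≢⇒< (≤-trans x≤len (≤-reflexive eq)) λ { refl → m∉ x∈ })

  decompose : ∀ {σ n} → length σ ≡ suc n → IsPermutation σ → 132-avoiding σ →
    ∃₂ λ L R → (IsPermutation L × 132-avoiding L) × (IsPermutation R × 132-avoiding R) × σ ≡ glue L R
  decompose {σ} {n} eq perm av with ∈-∃++ (max∈ perm eq)
  -- The length equation identifies `n` with `length A + length B`, so the letter at the cut takes
  -- the form that `Unglue` expects.
  ... | A , B , refl with suc-injective (trans (sym (+-suc (length A) (length B))) (trans (sym (length-++ A)) eq))
  ...   | refl = Unglue.unglue perm av

  -- The bijection between avoiders and pairs of smaller avoiders

  pairs : ℕ → List (Word × Word)
  pairs n = concatMap (λ i → cartesianProduct (𝒮₁₃₂ i) (𝒮₁₃₂ (n ∸ suc i))) (upTo n)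

  ∈-pairs⁻ : ∀ {n L R} → (L , R) ∈ pairs n →
    (IsPermutation L × 132-avoiding L) × (IsPermutation R × 132-avoiding R) × suc (length L + length R) ≡ n
  ∈-pairs⁻ {n} LR∈ with find (∈-concatMap⁻ _ {xs = upTo n} LR∈)
  ... | i , i∈ , LR∈ᵢ with ∈-cartesianProduct⁻ (𝒮₁₃₂ i) (𝒮₁₃₂ (n ∸ suc i)) LR∈ᵢ
  ...   | L∈ , R∈ with ∈-𝒮₁₃₂⁻ {i} L∈ | ∈-𝒮₁₃₂⁻ {n ∸ suc i} R∈
  ...     | refl , pL | lenR , pR = pL , pR , trans (cong (λ r → suc (i + r)) lenR) (m+[n∸m]≡n (∈-upTo⁻ i∈))

  ∈-pairs⁺ : ∀ {L R} → IsPermutation L × 132-avoiding L → IsPermutation R × 132-avoiding R →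
    (L , R) ∈ pairs (suc (length L + length R))
  ∈-pairs⁺ {L} {R} (pL , avL) (pR , avR) = ∈-concatMap⁺ _ (lose (∈-upTo⁺ (s≤s (m≤m+n (length L) (length R))))
    (∈-cartesianProduct⁺ (∈-𝒮₁₃₂⁺ pL avL)
      (subst (λ r → R ∈ 𝒮₁₃₂ r) (sym (m+n∸m≡n (length L) (length R))) (∈-𝒮₁₃₂⁺ pR avR))))

  -- Blocks with different `i` are disjoint because `i` is the length of the first component.
  pairs-unique : ∀ n → Unique (pairs n)
  pairs-unique n = Unique.concat⁺
    (All.map⁺ (All.universal (λ i → Unique.cartesianProduct⁺ (𝒮₁₃₂-unique i) (𝒮₁₃₂-unique (n ∸ suc i))) (upTo n)))
    (AllPairs.map⁺ (AllPairs.map disjoint (Unique.upTo⁺ n)))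
    where
    disjoint : ∀ {i j} → i ≢ j →
      Disjoint (cartesianProduct (𝒮₁₃₂ i) (𝒮₁₃₂ (n ∸ suc i)))
               (cartesianProduct (𝒮₁₃₂ j) (𝒮₁₃₂ (n ∸ suc j)))
    disjoint {i} {j} i≢j (∈ᵢ , ∈ⱼ) = i≢j (trans
      (sym (proj₁ (∈-𝒮₁₃₂⁻ {i} (proj₁ (∈-cartesianProduct⁻ (𝒮₁₃₂ i) (𝒮₁₃₂ (n ∸ suc i)) ∈ᵢ)))))
      (proj₁ (∈-𝒮₁₃₂⁻ {j} (proj₁ (∈-cartesianProduct⁻ (𝒮₁₃₂ j) (𝒮₁₃₂ (n ∸ suc j)) ∈ⱼ)))))

  glue-injective-pairs : ∀ {n x y} → x ∈ pairs n → y ∈ pairs n → uncurry glue x ≡ uncurry glue y → x ≡ y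
  glue-injective-pairs {n} x∈ y∈ eq =
    let (pL , _) , (pR , _) , _ = ∈-pairs⁻ {n} x∈
        (pL′ , _) , (pR′ , _) , _ = ∈-pairs⁻ {n} y∈
    in uncurry (cong₂ _,_) (glue-injective pL pR pL′ pR′ eq)

  glue-∈-𝒮₁₃₂ : ∀ {n L R} → (L , R) ∈ pairs n → glue L R ∈ 𝒮₁₃₂ n
  glue-∈-𝒮₁₃₂ {n} {L} {R} LR∈ =
    let (pL , avL) , (pR , avR) , len = ∈-pairs⁻ {n} LR∈
    in subst (λ k → glue L R ∈ 𝒮₁₃₂ k) (trans (Glue.length-glue pL pR) len)
         (∈-𝒮₁₃₂⁺ (Glue.glue-isPermutation pL pR) (Glue.glue-avoiding pL pR avL avR))

  ∈-glue-pairs : ∀ {n σ} → 1 ≤ n → σ ∈ 𝒮₁₃₂ n → σ ∈ map (uncurry glue) (pairs n)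
  ∈-glue-pairs {n} {σ} 1≤n σ∈ =
    let len , perm , av = ∈-𝒮₁₃₂⁻ {n} σ∈
        L , R , pL , pR , eq = decompose (trans len (sym (suc-pred n ⦃ >-nonZero 1≤n ⦄))) perm av
    in subst (_∈ map (uncurry glue) (pairs n)) (sym eq) (∈-map⁺ (uncurry glue)
         (subst (λ k → (L , R) ∈ pairs k)
           (trans (sym (Glue.length-glue (proj₁ pL) (proj₁ pR)))
                (trans (cong length (sym eq)) len)) (∈-pairs⁺ pL pR)))

  -- Repetition-free lists with the same members agree up to order, which is all that a sum sees. At
  -- `n = 0` the empty word has no largest entry to cut at, and `pairs` is empty.
  𝒮₁₃₂-↭ : ∀ n → 1 ≤ n → 𝒮₁₃₂ n ↭ map (uncurry glue) (pairs n)
  𝒮₁₃₂-↭ n 1≤n = ∼bag⇒↭ (unique∧set⇒bag (𝒮₁₃₂-unique n)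
    (Unique-map⁺-local (glue-injective-pairs {n}) (pairs-unique n)) (mk⇔ (∈-glue-pairs 1≤n) from))
    where
    from : ∀ {σ} → σ ∈ map (uncurry glue) (pairs n) → σ ∈ 𝒮₁₃₂ n
    from σ∈ =
      let (L , R) , LR∈ , eq = ∈-map⁻ (uncurry glue) {xs = pairs n} σ∈
      in subst (_∈ 𝒮₁₃₂ n) (sym eq) (glue-∈-𝒮₁₃₂ {n} LR∈)

open Combinatorics

module _ {c ℓ} (R : CommutativeRing c ℓ) where
  open CommutativeRing R
  open Generating R
  open import Algebra.Properties.CommutativeSemiring.Exp commutativeSemiring
    using (^-homo-*; ^-assocʳ; ^-distrib-*)
  open import Relation.Binary.Reasoning.Setoid setoid
  open Algebra.Solver.CommutativeMonoid *-commutativeMonoid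
    using (solve; _⊜_; id) renaming (_⊕_ to infixl 7 _⊗_)

  -- Finite sums in a commutative ring

  ∑-map : ∀ {a b} {A : Set a} {B : Set b} (g : A → B) as (f : B → Carrier) → ∑ (map g as) f ≡ ∑ as (f ∘ g)
  ∑-map g as f = ≡.cong (foldr _+_ 0#) (≡.sym (map-∘ as))

  module _ {a} {A : Set a} where

    ∑-cong : ∀ {as} {f g : A → Carrier} → (∀ {a} → a ∈ as → f a ≈ g a) → ∑ as f ≈ ∑ as g
    ∑-cong {[]}     f≈g = refl
    ∑-cong {x ∷ as} f≈g = +-cong (f≈g (here ≡.refl)) (∑-cong (f≈g ∘ there))

    ∑-++ : ∀ as bs (f : A → Carrier) → ∑ (as ++ bs) f ≈ ∑ as f + ∑ bs f
    ∑-++ []       bs f = sym (+-identityˡ _)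
    ∑-++ (x ∷ as) bs f = trans (+-congˡ (∑-++ as bs f)) (sym (+-assoc _ _ _))

    ∑-*ˡ : ∀ x as (f : A → Carrier) → ∑[ a ∈ as ] (x * f a) ≈ x * ∑ as f
    ∑-*ˡ x []       f = sym (zeroʳ x)
    ∑-*ˡ x (_ ∷ as) f = trans (+-congˡ (∑-*ˡ x as f)) (sym (distribˡ x _ _))

    ∑-↭ : ∀ {as bs} (f : A → Carrier) → as ↭ bs → ∑ as f ≈ ∑ bs f
    ∑-↭ f ↭.refl         = refl
    ∑-↭ f (↭.prep x p)   = +-congˡ (∑-↭ f p)
    ∑-↭ f (↭.swap x y p) =
      trans (trans (sym (+-assoc _ _ _)) (+-congʳ (+-comm _ _)))
            (trans (+-assoc _ _ _) (+-congˡ (+-congˡ (∑-↭ f p))))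
    ∑-↭ f (↭.trans p q)  = trans (∑-↭ f p) (∑-↭ f q)

  ∑-concatMap : ∀ {a b} {A : Set a} {B : Set b} (h : B → List A) bs (f : A → Carrier) →
                ∑ (concatMap h bs) f ≈ ∑[ b ∈ bs ] (∑ (h b) f)
  ∑-concatMap h []       f = refl
  ∑-concatMap h (b ∷ bs) f = trans (∑-++ (h b) _ f) (+-congˡ (∑-concatMap h bs f))

  -- The factor `x` is for the prefactor, which is constant on the pairs with given lengths;
  -- distributivity separates the two sums.
  ∑-cartesianProduct : ∀ {a b} {A : Set a} {B : Set b} x as bs (f : A → Carrier) (g : B → Carrier) →
    ∑[ p ∈ cartesianProduct as bs ] (x * f (proj₁ p) * g (proj₂ p)) ≈ x * ∑ as f * ∑ bs g
  ∑-cartesianProduct x []       bs f g = sym (trans (*-congʳ (zeroʳ x)) (zeroˡ _))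
  ∑-cartesianProduct x (a ∷ as) bs f g = begin
    ∑ (map (a ,_) bs ++ cartesianProduct as bs) h            ≈⟨ ∑-++ (map (a ,_) bs) _ h ⟩
    ∑ (map (a ,_) bs) h + ∑ (cartesianProduct as bs) h
      ≈⟨ +-cong (reflexive (∑-map (a ,_) bs h)) (∑-cartesianProduct x as bs f g) ⟩
    (∑[ b ∈ bs ] (x * f a * g b)) + x * ∑ as f * ∑ bs g        ≈⟨ +-congʳ (∑-*ˡ (x * f a) bs g) ⟩
    x * f a * ∑ bs g + x * ∑ as f * ∑ bs g                   ≈⟨ distribʳ _ _ _ ⟨
    (x * f a + x * ∑ as f) * ∑ bs g                          ≈⟨ *-congʳ (distribˡ x _ _) ⟨
    x * (f a + ∑ as f) * ∑ bs g                              ∎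
    where
    h = λ p → x * f (proj₁ p) * g (proj₂ p)

  -- The recurrence

  weight : (x₁ x₂ x₃ x₄ x₅ x₆ x₇ : Carrier) → Word → Carrier
  weight x₁ x₂ x₃ x₄ x₅ x₆ x₇ σ =
    x₁ ^ occr (1 ∷ 2 ∷ []) σ *
    x₂ ^ occr (2 ∷ 1 ∷ []) σ *
    x₃ ^ occr (1 ∷ 2 ∷ 3 ∷ []) σ *
    x₄ ^ occr (2 ∷ 1 ∷ 3 ∷ []) σ *
    x₅ ^ occr (2 ∷ 3 ∷ 1 ∷ []) σ *
    x₆ ^ occr (3 ∷ 1 ∷ 2 ∷ []) σ *
    x₇ ^ occr (3 ∷ 2 ∷ 1 ∷ []) σ

  private
    ^-+₂ : ∀ {e} x a b → e ≡ a ℕ.+ b → x ^ e ≈ x ^ a * x ^ b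
    ^-+₂ x a b ≡.refl = ^-homo-* x a b

    ^-+₃ : ∀ {e} x a b d → e ≡ a ℕ.+ b ℕ.+ d → x ^ e ≈ x ^ a * x ^ b * x ^ d
    ^-+₃ x a b d ≡.refl = trans (^-homo-* x (a ℕ.+ b) d) (*-congʳ (^-homo-* x a b))

    -- This is how a substitution records a linear count: with `x * y ^ r` for `x`, each of `k`
    -- occurrences brings `r` further factors `y`.
    ^-distrib-^ : ∀ x y r k → (x * y ^ r) ^ k ≈ x ^ k * y ^ (r ℕ.* k)
    ^-distrib-^ x y r k = trans (^-distrib-* x (y ^ r) k) (*-congˡ (^-assocʳ y r k))

  module _ (x₁ x₂ x₃ x₄ x₅ x₆ x₇ : Carrier) where

    -- Every exponent of the glued word splits into a constant, a part from `L` and a part from `M`.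
    -- The constants form the prefactor, and the terms linear in a count of 12 or 21 join the
    -- matching power of `x₁` or `x₂`.
    weight-glue : ∀ {L M} → IsPermutation L → IsPermutation M → let l = length L; r = length M in
      weight x₁ x₂ x₃ x₄ x₅ x₆ x₇ (glue L M) ≈
      x₁ ^ l * x₂ ^ (suc l ℕ.* r) * x₅ ^ (l ℕ.* r)
        * weight (x₁ * x₃ * x₅ ^ r) (x₂ * x₄ * x₇ ^ r) x₃ x₄ x₅ x₆ x₇ L
        * weight (x₁ * x₆ ^ suc l) (x₂ * x₇ ^ suc l) x₃ x₄ x₅ x₆ x₇ M
    weight-glue {L} {M} pL pM = begin
      weight x₁ x₂ x₃ x₄ x₅ x₆ x₇ (glue L M)
        ≈⟨ *-cong (*-cong (*-cong (*-cong (*-cong (*-cong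
             (^-+₃ x₁ l L12 M12 G.occr-glue-12)
             (^-+₃ x₂ (suc l ℕ.* r) L21 M21 G.occr-glue-21))
             (^-+₃ x₃ L123 L12 M123 G.occr-glue-123))
             (^-+₃ x₄ L213 L21 M213 G.occr-glue-213))
             (trans (^-+₃ x₅ (l ℕ.* r) (L231 ℕ.+ r ℕ.* L12) M231 G.occr-glue-231)
               (*-congʳ (*-congˡ (^-homo-* x₅ L231 (r ℕ.* L12))))))
             (trans (^-+₂ x₆ L312 (M312 ℕ.+ suc l ℕ.* M12) G.occr-glue-312)
               (*-congˡ (^-homo-* x₆ M312 (suc l ℕ.* M12)))))
             (trans (^-+₂ x₇ (L321 ℕ.+ r ℕ.* L21) (M321 ℕ.+ suc l ℕ.* M21) G.occr-glue-321)
               (*-cong (^-homo-* x₇ L321 (r ℕ.* L21)) (^-homo-* x₇ M321 (suc l ℕ.* M21)))) ⟩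
      _
        -- All 23 powers are treated as atoms. Letters that differ only in primes have exponents
        -- driven by the same count: `a` by 12 and `d` by 21 in `L`, `b` by 12 and `e` by 21 in `M`.
        ≈⟨ solve 23 (λ p a b q d e f a′ g h d′ k s m a″ n t u b″ v d″ w e″ →
             (p ⊗ a ⊗ b) ⊗ (q ⊗ d ⊗ e) ⊗ (f ⊗ a′ ⊗ g) ⊗ (h ⊗ d′ ⊗ k) ⊗ (s ⊗ (m ⊗ a″) ⊗ n)
               ⊗ (t ⊗ (u ⊗ b″)) ⊗ ((v ⊗ d″) ⊗ (w ⊗ e″))
             ⊜ p ⊗ q ⊗ s ⊗ (((a ⊗ a′) ⊗ a″) ⊗ ((d ⊗ d′) ⊗ d″) ⊗ f ⊗ h ⊗ m ⊗ t ⊗ v)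
                         ⊗ ((b ⊗ b″) ⊗ (e ⊗ e″) ⊗ g ⊗ k ⊗ n ⊗ u ⊗ w)) refl
             (x₁ ^ l) (x₁ ^ L12) (x₁ ^ M12)
             (x₂ ^ (suc l ℕ.* r)) (x₂ ^ L21) (x₂ ^ M21)
             (x₃ ^ L123) (x₃ ^ L12) (x₃ ^ M123)
             (x₄ ^ L213) (x₄ ^ L21) (x₄ ^ M213)
             (x₅ ^ (l ℕ.* r)) (x₅ ^ L231) (x₅ ^ (r ℕ.* L12)) (x₅ ^ M231)
             (x₆ ^ L312) (x₆ ^ M312) (x₆ ^ (suc l ℕ.* M12))
             (x₇ ^ L321) (x₇ ^ (r ℕ.* L21)) (x₇ ^ M321) (x₇ ^ (suc l ℕ.* M21)) ⟩
      _
        -- Read from right to left: expanding the powers of the substituted variables yields the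
        -- regrouped product.
        ≈⟨ *-cong
             (*-congˡ (*-congʳ (*-congʳ (*-congʳ (*-congʳ (*-congʳ
               (*-cong (collect x₁ x₃ x₅ L12) (collect x₂ x₄ x₇ L21))))))))
             (*-congʳ (*-congʳ (*-congʳ (*-congʳ (*-congʳ
               (*-cong (^-distrib-^ x₁ x₆ (suc l) M12) (^-distrib-^ x₂ x₇ (suc l) M21))))))) ⟨
      x₁ ^ l * x₂ ^ (suc l ℕ.* r) * x₅ ^ (l ℕ.* r)
        * weight (x₁ * x₃ * x₅ ^ r) (x₂ * x₄ * x₇ ^ r) x₃ x₄ x₅ x₆ x₇ L
        * weight (x₁ * x₆ ^ suc l) (x₂ * x₇ ^ suc l) x₃ x₄ x₅ x₆ x₇ M ∎
      where
      module G = Glue pL pM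
      l = length L
      r = length M
      L12 = occr (1 ∷ 2 ∷ []) L
      L21 = occr (2 ∷ 1 ∷ []) L
      L123 = occr (1 ∷ 2 ∷ 3 ∷ []) L
      L213 = occr (2 ∷ 1 ∷ 3 ∷ []) L
      L231 = occr (2 ∷ 3 ∷ 1 ∷ []) L
      L312 = occr (3 ∷ 1 ∷ 2 ∷ []) L
      L321 = occr (3 ∷ 2 ∷ 1 ∷ []) L
      M12 = occr (1 ∷ 2 ∷ []) M
      M21 = occr (2 ∷ 1 ∷ []) M
      M123 = occr (1 ∷ 2 ∷ 3 ∷ []) M
      M213 = occr (2 ∷ 1 ∷ 3 ∷ []) M
      M231 = occr (2 ∷ 3 ∷ 1 ∷ []) M
      M312 = occr (3 ∷ 1 ∷ 2 ∷ []) M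
      M321 = occr (3 ∷ 2 ∷ 1 ∷ []) M
      collect : ∀ x y z k → (x * y * z ^ r) ^ k ≈ x ^ k * y ^ k * z ^ (r ℕ.* k)
      collect x y z k = trans (^-distrib-^ (x * y) z r k) (*-congʳ (^-distrib-* x y k))

    -- The only summand is that of the empty word, where all seven exponents are 0.
    Q-zero : Q 0 x₁ x₂ x₃ x₄ x₅ x₆ x₇ ≈ 1#
    Q-zero = trans (+-identityʳ _) (solve 0 (id ⊗ id ⊗ id ⊗ id ⊗ id ⊗ id ⊗ id ⊜ id) refl)

    Q-suc : ∀ n → 1 ≤ n → Q n x₁ x₂ x₃ x₄ x₅ x₆ x₇ ≈
      (∑[ k ∈ [1⋯ n ] ]
        (x₁ ^ (k ∸ 1) * x₂ ^ (k ℕ.* (n ∸ k)) * x₅ ^ ((k ∸ 1) ℕ.* (n ∸ k))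
          * Q (k ∸ 1) (x₁ * x₃ * x₅ ^ (n ∸ k)) (x₂ * x₄ * x₇ ^ (n ∸ k)) x₃ x₄ x₅ x₆ x₇
          * Q (n ∸ k) (x₁ * x₆ ^ k) (x₂ * x₇ ^ k) x₃ x₄ x₅ x₆ x₇))
    Q-suc n 1≤n = begin
      ∑ (𝒮₁₃₂ n) w                                             ≈⟨ ∑-↭ w (𝒮₁₃₂-↭ n 1≤n) ⟩
      ∑ (map (uncurry glue) (pairs n)) w                       ≡⟨ ∑-map (uncurry glue) (pairs n) w ⟩
      ∑ (pairs n) (w ∘ uncurry glue)
        ≈⟨ ∑-concatMap (λ i → cartesianProduct (𝒮₁₃₂ i) (𝒮₁₃₂ (n ∸ suc i))) (upTo n) _ ⟩
      ∑[ i ∈ upTo n ] (∑ (cartesianProduct (𝒮₁₃₂ i) (𝒮₁₃₂ (n ∸ suc i))) (w ∘ uncurry glue))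
        ≈⟨ ∑-cong {as = upTo n} (λ {i} _ → block i) ⟩
      -- Here `i` is the length of the left part, so `k` is `suc i`, and `k ∸ 1` and `n ∸ k` are the
      -- two lengths.
      ∑[ i ∈ upTo n ] (term (suc i))                           ≡⟨ ∑-map suc (upTo n) term ⟨
      ∑ [1⋯ n ] term                                           ∎
      where
      w = weight x₁ x₂ x₃ x₄ x₅ x₆ x₇
      coeff : ℕ → ℕ → Carrier
      coeff i r = x₁ ^ i * x₂ ^ (suc i ℕ.* r) * x₅ ^ (i ℕ.* r)
      wL wR : ℕ → Word → Carrier
      wL r = weight (x₁ * x₃ * x₅ ^ r) (x₂ * x₄ * x₇ ^ r) x₃ x₄ x₅ x₆ x₇
      wR k = weight (x₁ * x₆ ^ k) (x₂ * x₇ ^ k) x₃ x₄ x₅ x₆ x₇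
      term : ℕ → Carrier
      term k = x₁ ^ (k ∸ 1) * x₂ ^ (k ℕ.* (n ∸ k)) * x₅ ^ ((k ∸ 1) ℕ.* (n ∸ k))
        * Q (k ∸ 1) (x₁ * x₃ * x₅ ^ (n ∸ k)) (x₂ * x₄ * x₇ ^ (n ∸ k)) x₃ x₄ x₅ x₆ x₇
        * Q (n ∸ k) (x₁ * x₆ ^ k) (x₂ * x₇ ^ k) x₃ x₄ x₅ x₆ x₇
      -- Matching on the length equations replaces the lengths in `weight-glue` by `i` and `r`, so
      -- prefactor and substitutions are the same throughout a block.
      pointwise : ∀ {i r L M} → length L ≡ i × IsPermutation L × 132-avoiding L →
                  length M ≡ r × IsPermutation M × 132-avoiding M →
                  w (glue L M) ≈ coeff i r * wL r L * wR (suc i) M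
      pointwise (≡.refl , pL , _) (≡.refl , pM , _) = weight-glue pL pM
      block : ∀ i → ∑ (cartesianProduct (𝒮₁₃₂ i) (𝒮₁₃₂ (n ∸ suc i))) (w ∘ uncurry glue) ≈ term (suc i)
      block i = trans
        (∑-cong {as = cartesianProduct (𝒮₁₃₂ i) (𝒮₁₃₂ (n ∸ suc i))} λ LM∈ →
          let L∈ , M∈ = ∈-cartesianProduct⁻ (𝒮₁₃₂ i) (𝒮₁₃₂ (n ∸ suc i)) LM∈
          in pointwise (∈-𝒮₁₃₂⁻ {i} L∈) (∈-𝒮₁₃₂⁻ {n ∸ suc i} M∈))
        (∑-cartesianProduct (coeff i (n ∸ suc i)) (𝒮₁₃₂ i) (𝒮₁₃₂ (n ∸ suc i)) (wL (n ∸ suc i)) (wR (suc i)))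

theorem2 : ∀ {c ℓ} (R : CommutativeRing c ℓ) →
    let open CommutativeRing R
        open Generating R
    in
    (x₁ x₂ x₃ x₄ x₅ x₆ x₇ : Carrier) →
    (Q 0 x₁ x₂ x₃ x₄ x₅ x₆ x₇ ≈ 1#) ×
    ((n : ℕ) → 1 ≤ n →
      Q n x₁ x₂ x₃ x₄ x₅ x₆ x₇ ≈
      (∑[ k ∈ [1⋯ n ] ]
        (x₁ ^ (k ∸ 1) * x₂ ^ (k ℕ.* (n ∸ k)) * x₅ ^ ((k ∸ 1) ℕ.* (n ∸ k))
          * Q (k ∸ 1) (x₁ * x₃ * x₅ ^ (n ∸ k)) (x₂ * x₄ * x₇ ^ (n ∸ k)) x₃ x₄ x₅ x₆ x₇
          * Q (n ∸ k) (x₁ * x₆ ^ k) (x₂ * x₇ ^ k) x₃ x₄ x₅ x₆ x₇)))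
theorem2 R x₁ x₂ x₃ x₄ x₅ x₆ x₇ = Q-zero R x₁ x₂ x₃ x₄ x₅ x₆ x₇ , Q-suc R x₁ x₂ x₃ x₄ x₅ x₆ x₇
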